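{- For every integer $\Delta\ge8$, \[ c_\Delta\ge\frac1\Delta-6\,\Delta^{ -4/3}. \] Furthermore, \[ \lim_{\Delta\to\infty}\Delta\, c_\Delta=1 . \]
   Context: All graphs are finite, simple and undirected. $\Delta(G)$ denotes the maximum degree of $G$. A set $T\subseteq V(G)$ is an identifying vertex cover if $e\cap T\neq\emptyset$ for every $e\in E(G)$ and the sets $e\cap T$ ($e\in E(G)$) are pairwise distinct; $\tau_D(G)$ is the minimum cardinality of an identifying vertex cover of $G$. For a graph $G$ of order $n$, size $m$ and maximum degree $\Delta$, \[ \mathsf{B}_{\mathrm{HY}}(G)=\frac{\Delta(\Delta-1)n+2m}{\Delta^2+1}. \] For an integer $\Delta\ge4$, \[ c_\Delta=\sup\left\{\frac{\tau_D(G)-\mathsf{B}_{\mathrm{HY}}(G)}{|V(G)|}: G\text{ is connected and }\Delta(G)=\Delta\right\} \] (maximum degree exactly $\Delta$). -}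

module Defs where

open import Data.Bool.Base using (Bool; true; false)
import Data.Bool.Properties as Bool
open import Data.Fin.Base as Fin using (Fin)
import Data.Fin.Properties as Fin
open import Data.Fin.Subset using (Subset; _∈_; ⁅_⁆; _∪_; _∩_; ∁; ∣_∣; Nonempty; ⊤)
open import Data.Fin.Subset.Properties
  using (anySubset?; nonempty?; ∣p∣≤n; ∣⁅x⁆∣≡1; ∣∁p∣≡n∸∣p∣; x∈⁅x⁆; x∈⁅y⁆⇒x≡y
        ; x∉p⇒x∈∁p; x∈p⇒x∉∁p; p⊆p∪q; ∩-identityʳ)
open import Data.Integer.Base as ℤ using (+_)
import Data.Integer.Properties as ℤ
open import Data.List.Base as List using (List; allFin; cartesianProduct; filter; length)
open import Data.List.Extrema.Nat using (max; max≤v⁺; v≤max⁺)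
open import Data.List.Membership.Propositional using () renaming (_∈_ to _∈ˡ_)
open import Data.List.Membership.Propositional.Properties using (∈-map⁻)
open import Data.List.Relation.Unary.All as All using (All)
import Data.List.Relation.Unary.All.Properties as All
open import Data.List.Relation.Unary.Any using (here)
open import Data.Nat.Base as ℕ using (ℕ; zero; suc; NonZero)
import Data.Nat.Properties as ℕ
open import Data.Product.Base using (Σ; ∃; ∃-syntax; ∃₂; _×_; _,_; proj₁; proj₂)
open import Data.Rational.Base as ℚ
  using (ℚ; 0ℚ; 1ℚ; _/_; _+_; _-_; _*_; -_; _≤_; _<_)
import Data.Rational.Properties as ℚ
import Data.Rational.Unnormalised.Base as ℚᵘ
import Data.Rational.Unnormalised.Properties as ℚᵘ
open import Data.Sum.Base using (inj₁; inj₂)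
open import Data.Vec.Base as Vec using (lookup; tabulate)
import Data.Vec.Properties as Vec
open import Function.Base using (_∘_)
open import Relation.Binary.Construct.Closure.ReflexiveTransitive using (Star; ε; _◅_)
open import Relation.Binary.Definitions using (DecidableEquality)
open import Relation.Binary.PropositionalEquality
open import Relation.Nullary using (¬_; Dec; yes; no; ¬?; contradiction; _×-dec_; _→-dec_)
import Relation.Nullary.Decidable as Dec

record Graph (n : ℕ) : Set where
  field
    adj     : Fin n → Fin n → Bool
    adj-sym : ∀ u v → adj u v ≡ adj v u
    adj-irr : ∀ u → adj u u ≡ false

  Adj : Fin n → Fin n → Set
  Adj u v = adj u v ≡ true

  -- Each edge, as a two-element vertex set, is listed exactly once,
  -- namely for its ordered pair of ends u < v.
  edges : List (Subset n)
  edges = List.map (λ (u , v) → ⁅ u ⁆ ∪ ⁅ v ⁆)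
            (filter (λ (u , v) → (u Fin.<? v) ×-dec (adj u v Bool.≟ true))
              (cartesianProduct (allFin n) (allFin n)))

  size : ℕ
  size = length edges

  neighbourhood : Fin n → Subset n
  neighbourhood u = tabulate (adj u)

  degree : Fin n → ℕ
  degree u = ∣ neighbourhood u ∣

  maxDegree : ℕ
  maxDegree = max 0 (List.map degree (allFin n))

  Connected : Set
  Connected = NonZero n × (∀ u v → Star Adj u v)

  record IdentifyingVertexCover (T : Subset n) : Set where
    constructor mkIVC
    field
      covers   : ∀ {e} → e ∈ˡ edges → Nonempty (e ∩ T)
      distinct : ∀ {e f} → e ∈ˡ edges → f ∈ˡ edges → e ≢ f → e ∩ T ≢ f ∩ T

open Graph public

_≟ˢ_ : ∀ {n} → DecidableEquality (Subset n)
_≟ˢ_ = Vec.≡-dec Bool._≟_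

identifyingVertexCover? : ∀ {n} (G : Graph n) (T : Subset n) →
                          Dec (IdentifyingVertexCover G T)
identifyingVertexCover? G T = Dec.map′ to from
  (All.all? (λ e → nonempty? (e ∩ T)) (edges G) ×-dec
   All.all? (λ e → All.all? (λ f → ¬? (e ≟ˢ f) →-dec ¬? ((e ∩ T) ≟ˢ (f ∩ T)))
                            (edges G)) (edges G))
  where
  P = All (λ e → Nonempty (e ∩ T)) (edges G)
      × All (λ e → All (λ f → e ≢ f → e ∩ T ≢ f ∩ T) (edges G)) (edges G)

  to : P → IdentifyingVertexCover G T
  to (c , d) = mkIVC (All.lookup c) (λ e∈ f∈ → All.lookup (All.lookup d e∈) f∈)

  from : IdentifyingVertexCover G T → P
  from (mkIVC c d) = All.tabulate c , All.tabulate (λ e∈ → All.tabulate (λ f∈ → d e∈ f∈))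

IVC-⊤ : ∀ {n} (G : Graph n) → IdentifyingVertexCover G ⊤
IVC-⊤ G = mkIVC cov λ {e} {f} _ _ e≢f eq →
    e≢f (trans (sym (∩-identityʳ e)) (trans eq (∩-identityʳ f)))
  where
  cov : ∀ {e} → e ∈ˡ edges G → Nonempty (e ∩ ⊤)
  cov {e} e∈ with ∈-map⁻ _ e∈
  ... | (u , v) , _ , refl =
    subst Nonempty (sym (∩-identityʳ e)) (u , p⊆p∪q ⁅ v ⁆ (x∈⁅x⁆ u))

IsMinimumIVCSize : ∀ {n} → Graph n → ℕ → Set
IsMinimumIVCSize G k =
  (∃[ T ] IdentifyingVertexCover G T × ∣ T ∣ ≡ k) ×
  (∀ T → IdentifyingVertexCover G T → k ℕ.≤ ∣ T ∣)

minimumIVC : ∀ {n} (G : Graph n) → ∃ (IsMinimumIVCSize G)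
minimumIVC {n} G = search n ⊤ (IVC-⊤ G) (∣p∣≤n ⊤)
  where
  search : ∀ fuel T → IdentifyingVertexCover G T → ∣ T ∣ ℕ.≤ fuel → ∃ (IsMinimumIVCSize G)
  search fuel T ivc T≤fuel
    with anySubset? (λ T′ → identifyingVertexCover? G T′ ×-dec (∣ T′ ∣ ℕ.<? ∣ T ∣))
  ... | no  none = ∣ T ∣ , (T , ivc , refl) ,
                   λ T′ ivc′ → ℕ.≮⇒≥ (λ lt → none (T′ , ivc′ , lt))
  search zero       T ivc T≤0 | yes (_ , _ , lt)        =
    contradiction (ℕ.<-≤-trans lt T≤0) ℕ.n≮0
  search (suc fuel) T ivc T≤  | yes (T′ , ivc′ , lt) =
    search fuel T′ ivc′ (ℕ.s≤s⁻¹ (ℕ.<-≤-trans lt T≤))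

τD : ∀ {n} → Graph n → ℕ
τD G = proj₁ (minimumIVC G)

BHY : ∀ {n} → Graph n → ℚ
BHY {n} G = + (Δ ℕ.* (Δ ℕ.∸ 1) ℕ.* n ℕ.+ 2 ℕ.* size G) / (1 ℕ.+ Δ ℕ.^ 2)
  where Δ = maxDegree G

normalisedExcess : ∀ {n} .{{_ : NonZero n}} → Graph n → ℚ
normalisedExcess {n} G = (+ τD G / 1 - BHY G) * (+ 1 / n)

-- A real number is represented by the open lower Dedekind cut of the
-- rationals strictly below it.  Unlike located two-sided cuts, such cuts
-- are closed under suprema of arbitrary inhabited bounded sets without
-- appeal to classical logic; classically they are the usual reals.

record ℝ : Set₁ where
  field
    L         : ℚ → Set
    inhabited : ∃[ q ] L q
    bounded   : ∃[ q ] ¬ L q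
    lower     : ∀ {p q} → p < q → L q → L p
    rounded   : ∀ {p} → L p → ∃[ q ] p < q × L q

open ℝ public

infix 4 _≤ʳ_ _≥ʳ_

_≤ʳ_ _≥ʳ_ : ℝ → ℝ → Set
x ≤ʳ y = ∀ q → L x q → L y q
x ≥ʳ y = y ≤ʳ x

p-1<p : ∀ p → p - 1ℚ < p
p-1<p p = subst (p - 1ℚ <_) (ℚ.+-identityʳ p) (ℚ.+-monoʳ-< p (ℚ.negative⁻¹ (- 1ℚ)))

sup : (S : ℚ → Set) → ∃ S → (∃[ b ] ∀ p → S p → p ≤ b) → ℝ
sup S (s , Ss) (b , S≤b) = record
  { L         = λ q → ∃[ p ] S p × q < p
  ; inhabited = s - 1ℚ , s , Ss , p-1<p s
  ; bounded   = b , λ (p , Sp , b<p) → ℚ.<-irrefl refl (ℚ.<-≤-trans b<p (S≤b p Sp))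
  ; lower     = λ p<q (r , Sr , q<r) → r , Sr , ℚ.<-trans p<q q<r
  ; rounded   = λ (r , Sr , p<r) → let m , p<m , m<r = ℚ.<-dense p<r in
                                   m , p<m , r , Sr , m<r
  }

fromℚ : ℚ → ℝ
fromℚ r = record
  { L         = _< r
  ; inhabited = r - 1ℚ , p-1<p r
  ; bounded   = r , ℚ.<-irrefl refl
  ; lower     = ℚ.<-trans
  ; rounded   = λ p<r → let m , p<m , m<r = ℚ.<-dense p<r in m , p<m , m<r
  }

below : ∀ x {p b} → L x p → ¬ L x b → p ≤ b
below x {p} {b} Lp ¬Lb = ℚ.≮⇒≥ (λ b<p → ¬Lb (lower x b<p Lp))

infixl 6 _-ʳ_
infixr 7 _·_

-- ¬ L y b says y ≤ b, so these are the differences a - b with a < x, y ≤ b.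
_-ʳ_ : ℝ → ℝ → ℝ
x -ʳ y = sup (λ q → ∃₂ λ a b → L x a × ¬ L y b × q ≡ a - b)
  (let a , La = inhabited x ; b , ¬Lb = bounded y in a - b , a , b , La , ¬Lb , refl)
  (let a₀ , ¬La₀ = bounded x ; b₀ , Lb₀ = inhabited y in a₀ - b₀ ,
   λ { _ (a , b , La , ¬Lb , refl) →
       ℚ.+-mono-≤ (below x La ¬La₀) (ℚ.neg-antimono-≤ (below y Lb₀ ¬Lb)) })

_·_ : ℕ → ℝ → ℝ
k · x = sup (λ q → ∃[ p ] L x p × q ≡ (+ k / 1) * p)
  (let p , Lp = inhabited x in _ , p , Lp , refl)
  (let b , ¬Lb = bounded x in (+ k / 1) * b ,
   λ { _ (p , Lp , refl) →
       ℚ.*-monoˡ-≤-nonNeg (+ k / 1) {{ℚ.normalize-nonNeg k 1}} (below x Lp ¬Lb) })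

∛ : (r : ℚ) .{{_ : ℚ.NonNegative r}} → ℝ
∛ r = sup (λ q → q * q * q ≤ r)
  (0ℚ , ℚ.nonNegative⁻¹ r)
  (1ℚ + r , λ q q³≤r → ℚ.≮⇒≥ (λ 1+r<q → ℚ.<-irrefl refl (ℚ.<-≤-trans (r<q³ 1+r<q) q³≤r)))
  where
  r<q³ : ∀ {q} → 1ℚ + r < q → r < q * q * q
  r<q³ {q} 1+r<q = ℚ.<-≤-trans r<q (ℚ.≤-trans (grow q 0≤q) (grow (q * q) 0≤q²))
    where
    1<q : 1ℚ < q
    1<q = ℚ.≤-<-trans (subst (_≤ 1ℚ + r) (ℚ.+-identityʳ 1ℚ)
                        (ℚ.+-monoʳ-≤ 1ℚ (ℚ.nonNegative⁻¹ r))) 1+r<q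
    r<q : r < q
    r<q = ℚ.≤-<-trans (subst (_≤ 1ℚ + r) (ℚ.+-identityˡ r)
                        (ℚ.+-monoˡ-≤ r (ℚ.nonNegative⁻¹ 1ℚ))) 1+r<q
    0≤q : 0ℚ ≤ q
    0≤q = ℚ.≤-trans (ℚ.nonNegative⁻¹ 1ℚ) (ℚ.<⇒≤ 1<q)
    grow : ∀ s → 0ℚ ≤ s → s ≤ s * q
    grow s 0≤s = subst (_≤ s * q) (ℚ.*-identityʳ s)
                   (ℚ.*-monoˡ-≤-nonNeg s {{ℚ.nonNegative 0≤s}} (ℚ.<⇒≤ 1<q))
    0≤q² : 0ℚ ≤ q * q
    0≤q² = ℚ.≤-trans 0≤q (grow q 0≤q)

_^-4/3 : (k : ℕ) .{{_ : NonZero k}} → ℝ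
k ^-4/3 = ∛ (+ 1 / k ℕ.^ 4)
  {{ℚ.normalize-nonNeg 1 (k ℕ.^ 4) {{ℕ.m^n≢0 k 4}}}}
  where instance _ = ℕ.m^n≢0 k 4

-- The two inequalities say |a k - ℓ| ≤ η.
_⟶_ : (ℕ → ℝ) → ℝ → Set
a ⟶ ℓ = ∀ (η : ℚ) → 0ℚ < η → ∃[ N ] ∀ k → N ℕ.≤ k →
          (ℓ -ʳ fromℚ η ≤ʳ a k) × (a k -ʳ fromℚ η ≤ʳ ℓ)

Excess : ℕ → ℚ → Set
Excess Δ q = ∃[ n ] Σ (Graph n) λ G → Σ (Connected G) λ (n≢0 , _) →
  maxDegree G ≡ Δ × q ≡ normalisedExcess {{n≢0}} G

-- Complete graphs witness that the supremum is over a nonempty set.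
complete : ∀ n → Graph n
complete n = record
  { adj     = λ u v → lookup (∁ ⁅ u ⁆) v
  ; adj-sym = sym′
  ; adj-irr = λ u → off u u (λ u∈ → x∈p⇒x∉∁p (x∈⁅x⁆ u) u∈)
  }
  where
  off : ∀ u v → ¬ (v ∈ ∁ ⁅ u ⁆) → lookup (∁ ⁅ u ⁆) v ≡ false
  off u v v∉ = Bool.¬-not (v∉ ∘ Vec.lookup⇒[]= v (∁ ⁅ u ⁆))
  on : ∀ u v → u ≢ v → lookup (∁ ⁅ u ⁆) v ≡ true
  on u v u≢v = Vec.[]=⇒lookup (x∉p⇒x∈∁p (λ v∈ → u≢v (sym (x∈⁅y⁆⇒x≡y u v∈))))
  sym′ : ∀ u v → lookup (∁ ⁅ u ⁆) v ≡ lookup (∁ ⁅ v ⁆) u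
  sym′ u v with u Fin.≟ v
  ... | yes refl = refl
  ... | no  u≢v  = trans (on u v u≢v) (sym (on v u (u≢v ∘ sym)))

complete-connected : ∀ n → Connected (complete (suc n))
complete-connected n = _ , path
  where
  path : ∀ u v → Star (Adj (complete (suc n))) u v
  path u v with u Fin.≟ v
  ... | yes refl = ε
  ... | no  u≢v  =
    Vec.[]=⇒lookup (x∉p⇒x∈∁p (λ v∈ → u≢v (sym (x∈⁅y⁆⇒x≡y u v∈)))) ◅ ε

complete-maxDegree : ∀ n → maxDegree (complete (suc n)) ≡ n
complete-maxDegree n = ℕ.≤-antisym
  (max≤v⁺ {xs = degs} ℕ.z≤n (All.map⁺ (All.universal (λ u → ℕ.≤-reflexive (deg u)) (allFin (suc n)))))
  (v≤max⁺ 0 degs (inj₂ (here (ℕ.≤-reflexive (sym (deg Fin.zero))))))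
  where
  degs = List.map (degree (complete (suc n))) (allFin (suc n))
  deg : ∀ u → degree (complete (suc n)) u ≡ n
  deg u = trans (cong ∣_∣ (Vec.tabulate∘lookup (∁ ⁅ u ⁆)))
            (trans (∣∁p∣≡n∸∣p∣ ⁅ u ⁆) (cong (suc n ℕ.∸_) (∣⁅x⁆∣≡1 u)))

normalisedExcess≤1 : ∀ {n} .{{_ : NonZero n}} (G : Graph n) → normalisedExcess G ≤ 1ℚ
normalisedExcess≤1 {n} G = begin
  (τ - BHY G) * (+ 1 / n)  ≤⟨ ℚ.*-monoʳ-≤-nonNeg (+ 1 / n) {{ℚ.normalize-nonNeg 1 n}} τ-B≤n ⟩
  (+ n / 1) * (+ 1 / n)    ≡⟨ n*1/n ⟩
  1ℚ                       ∎
  where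
  open ℚ.≤-Reasoning
  τ = + τD G / 1

  0≤B : 0ℚ ≤ BHY G
  0≤B = ℚ.nonNegative⁻¹ (BHY G)
    {{ℚ.normalize-nonNeg (Δ ℕ.* (Δ ℕ.∸ 1) ℕ.* n ℕ.+ 2 ℕ.* size G) (1 ℕ.+ Δ ℕ.^ 2)}}
    where Δ = maxDegree G

  τ≤n : τ ≤ + n / 1
  τ≤n = ℚ.toℚᵘ-cancel-≤ (ℚᵘ.≤-respˡ-≃ (ℚᵘ.≃-sym (ℚ.toℚᵘ-fromℚᵘ (ℚᵘ.mkℚᵘ (+ τD G) 0)))
          (ℚᵘ.≤-respʳ-≃ (ℚᵘ.≃-sym (ℚ.toℚᵘ-fromℚᵘ (ℚᵘ.mkℚᵘ (+ n) 0)))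
          (ℚᵘ.*≤* (subst₂ ℤ._≤_ (sym (ℤ.*-identityʳ (+ τD G))) (sym (ℤ.*-identityʳ (+ n))) (ℤ.+≤+ τD≤n)))))
    where
    τD≤n : τD G ℕ.≤ n
    τD≤n = ℕ.≤-trans (proj₂ (proj₂ (minimumIVC G)) ⊤ (IVC-⊤ G)) (∣p∣≤n {n} ⊤)

  τ-B≤n : τ - BHY G ≤ + n / 1
  τ-B≤n = ℚ.≤-trans
    (subst (τ - BHY G ≤_) (ℚ.+-identityʳ τ) (ℚ.+-monoʳ-≤ τ (ℚ.neg-antimono-≤ 0≤B))) τ≤n

  n*1/n : (+ n / 1) * (+ 1 / n) ≡ 1ℚ
  n*1/n = lemma n
    where
    lemma : ∀ n .{{_ : NonZero n}} → (+ n / 1) * (+ 1 / n) ≡ 1ℚ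
    lemma (suc m) = ℚ.toℚᵘ-injective
      (ℚᵘ.≃-trans (ℚ.toℚᵘ-homo-* (+ suc m / 1) (+ 1 / suc m))
      (ℚᵘ.≃-trans (ℚᵘ.*-cong (ℚ.toℚᵘ-fromℚᵘ (ℚᵘ.mkℚᵘ (+ suc m) 0))
                             (ℚ.toℚᵘ-fromℚᵘ (ℚᵘ.mkℚᵘ (+ 1) m)))
                  (ℚᵘ.*-inverseʳ (ℚᵘ.mkℚᵘ (+ suc m) 0))))

c : ℕ → ℝ
c Δ = sup (Excess Δ)
  (_ , suc Δ , complete (suc Δ) , complete-connected Δ , complete-maxDegree Δ , refl)
  (1ℚ , λ { _ (n , G , (n≢0 , _) , _ , refl) → normalisedExcess≤1 {{n≢0}} G })

{-# OPTIONS --safe #-}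

-- The complement of an identifying vertex cover is a set of vertices at pairwise
-- distance at least 3, so τ_D ≥ n − 2 as soon as some root r is such that any two
-- non-neighbours of r have a common neighbour.  If moreover m ≤ Δ², then the
-- normalised excess is at least 1/Δ − 4/n, and it remains to make n large.
-- Split ks points into k blocks of size s ≈ Δ/2 with k ≈ √Δ, join every pair of
-- blocks to one of Δ hubs, and join all hubs to r.  Then n ≥ Δ(k + 1)/2, whence
-- 4/n = O(Δ^(-3/2)).  In the other direction, τ_D ≤ n alone bounds the normalised
-- excess by (Δ + 1)/(Δ² + 1).
module Submission where

open import Defs
open import Data.Bool.Base using (Bool; true; false; _∨_)
import Data.Bool.Properties as Bool
open import Data.Fin.Base as Fin
  using (Fin; zero; suc; _↑ˡ_; _↑ʳ_; splitAt; combine; remQuot; quotient)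
import Data.Fin.Properties as Fin
open import Data.Fin.Subset
  using (Subset; inside; outside; _∈_; _∉_; _⊆_; ⁅_⁆; _∪_; _∩_; ∁; ∣_∣; ⋃; ⊤)
open import Data.Fin.Subset.Properties
  using (_∈?_; drop-there; nonempty?; p⊆q⇒∣p∣≤∣q∣; ∣⊥∣≡0; ∣⁅x⁆∣≡1; ∣∁p∣≡n∸∣p∣; ∣p∣≤n
        ; x∈⁅x⁆; x∈⁅y⁆⇒x≡y; x∉p⇒x∈∁p; x∈∁p⇒x∉p; x∈p∪q⁺; x∈p∪q⁻; x∈p∩q⁺; x∈p∩q⁻
        ; ∪-comm; ⊆-antisym)
open import Data.Integer.Base as ℤ using (+_; +[1+_]; -[1+_])
import Data.Integer.Properties as ℤ
open import Data.List.Base as List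
  using (List; []; _∷_; _++_; allFin; cartesianProduct; filter; length; map)
open import Data.List.Extrema.Nat using (max≤v⁺; v≤max⁺)
open import Data.List.Membership.Propositional using () renaming (_∈_ to _∈ˡ_)
open import Data.List.Membership.Propositional.Properties
  using (∈-map⁺; ∈-filter⁺; ∈-cartesianProduct⁺; ∈-allFin; ∈-++⁺ˡ; ∈-++⁺ʳ)
import Data.List.Properties as List
import Data.List.Relation.Unary.All as All
import Data.List.Relation.Unary.All.Properties as All
open import Data.List.Relation.Unary.Any as Any using (here; there)
open import Data.Nat.Base
  using (ℕ; zero; suc; NonZero; _≤_; _<_; z≤n; s≤s; _+_; _*_; _∸_; _^_)
open import Data.Nat.Properties
open import Data.Nat.Tactic.RingSolver using (solve-∀)
open import Data.Product.Base using (Σ; ∃-syntax; _×_; _,_; proj₁; proj₂)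
open import Data.Rational.Base as ℚ using (ℚ; mkℚ; 0ℚ; 1ℚ; _/_)
import Data.Rational.Properties as ℚ
open import Data.Rational.Solver using (module +-*-Solver)
import Data.Rational.Unnormalised.Base as ℚᵘ
import Data.Rational.Unnormalised.Properties as ℚᵘ
open import Data.Sum.Base using (_⊎_; inj₁; inj₂; [_,_]′)
import Data.Vec.Base as Vec
import Data.Vec.Properties as Vec
open import Function.Base using (_∘_; id)
open import Relation.Binary.Construct.Closure.ReflexiveTransitive
  using (Star; ε; _◅_; _◅◅_; reverse)
open import Relation.Binary.Definitions using (tri<; tri≈; tri>)
open import Relation.Binary.PropositionalEquality
open import Relation.Nullary using (¬_; yes; no; contradiction; does; _×-dec_)
open import Relation.Nullary.Decidable using (dec-true)
open import Relation.Unary using (Decidable)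

-- Counting elements of subsets and of filtered lists.

∣p∪q∣≤∣p∣+∣q∣ : ∀ {n} (p q : Subset n) → ∣ p ∪ q ∣ ≤ ∣ p ∣ + ∣ q ∣
∣p∪q∣≤∣p∣+∣q∣ Vec.[]              Vec.[]              = z≤n
∣p∪q∣≤∣p∣+∣q∣ (outside Vec.∷ p) (outside Vec.∷ q) = ∣p∪q∣≤∣p∣+∣q∣ p q
∣p∪q∣≤∣p∣+∣q∣ (outside Vec.∷ p) (inside  Vec.∷ q) =
  ≤-trans (s≤s (∣p∪q∣≤∣p∣+∣q∣ p q)) (≤-reflexive (sym (+-suc ∣ p ∣ ∣ q ∣)))
∣p∪q∣≤∣p∣+∣q∣ (inside  Vec.∷ p) (outside Vec.∷ q) = s≤s (∣p∪q∣≤∣p∣+∣q∣ p q)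
∣p∪q∣≤∣p∣+∣q∣ (inside  Vec.∷ p) (inside  Vec.∷ q) =
  s≤s (≤-trans (∣p∪q∣≤∣p∣+∣q∣ p q) (+-monoʳ-≤ ∣ p ∣ (n≤1+n ∣ q ∣)))

-- Cardinality is subadditive over the union of the singletons of `xs`. Repetitions in `xs` are
-- allowed, so it applies to a hub whose two blocks coincide.
p⊆list⇒∣p∣≤length : ∀ {n} (p : Subset n) xs → (∀ {x} → x ∈ p → x ∈ˡ xs) → ∣ p ∣ ≤ length xs
p⊆list⇒∣p∣≤length {n} p xs p⊆xs =
  ≤-trans (p⊆q⇒∣p∣≤∣q∣ (λ x∈p → ∈-set (p⊆xs x∈p))) (∣set∣ xs)
  where
  set : List (Fin n) → Subset n
  set xs = ⋃ (map ⁅_⁆ xs)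

  ∈-set : ∀ {x xs} → x ∈ˡ xs → x ∈ set xs
  ∈-set (here refl) = x∈p∪q⁺ (inj₁ (x∈⁅x⁆ _))
  ∈-set (there x∈)  = x∈p∪q⁺ (inj₂ (∈-set x∈))

  ∣set∣ : ∀ xs → ∣ set xs ∣ ≤ length xs
  ∣set∣ []       = ≤-reflexive (∣⊥∣≡0 n)
  ∣set∣ (x ∷ xs) = ≤-trans (∣p∪q∣≤∣p∣+∣q∣ ⁅ x ⁆ (set xs))
                     (+-mono-≤ (≤-reflexive (∣⁅x⁆∣≡1 x)) (∣set∣ xs))

subsingleton⇒∣p∣≤1 : ∀ {n} (p : Subset n) → (∀ {x y} → x ∈ p → y ∈ p → x ≡ y) → ∣ p ∣ ≤ 1
subsingleton⇒∣p∣≤1 p eq with nonempty? p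
... | yes (x , x∈p) = p⊆list⇒∣p∣≤length p (x ∷ []) (λ y∈p → here (eq y∈p x∈p))
... | no  empty     = ≤-trans (p⊆list⇒∣p∣≤length p [] (λ x∈p → contradiction (_ , x∈p) empty)) z≤n

∣p∣≤∣p∩q∣+∣p∩∁q∣ : ∀ {n} (p q : Subset n) → ∣ p ∣ ≤ ∣ p ∩ q ∣ + ∣ p ∩ ∁ q ∣
∣p∣≤∣p∩q∣+∣p∩∁q∣ p q = ≤-trans (p⊆q⇒∣p∣≤∣q∣ split) (∣p∪q∣≤∣p∣+∣q∣ (p ∩ q) (p ∩ ∁ q))
  where
  split : p ⊆ (p ∩ q) ∪ (p ∩ ∁ q)
  split {x} x∈p with x ∈? q
  ... | yes x∈q = x∈p∪q⁺ (inj₁ (x∈p∩q⁺ (x∈p , x∈q)))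
  ... | no  x∉q = x∈p∪q⁺ (inj₂ (x∈p∩q⁺ (x∈p , x∉p⇒x∈∁p x∉q)))

-- Bounds the degree of the root from below: the hubs are the first vertices in the numbering.
prefix⊆p⇒a≤∣p∣ : ∀ {b} a (p : Subset (a + b)) → (∀ i → i ↑ˡ b ∈ p) → a ≤ ∣ p ∣
prefix⊆p⇒a≤∣p∣ zero    p                  _    = z≤n
prefix⊆p⇒a≤∣p∣ (suc a) (inside  Vec.∷ p) incl =
  s≤s (prefix⊆p⇒a≤∣p∣ a p (λ i → drop-there (incl (suc i))))
prefix⊆p⇒a≤∣p∣ (suc a) (outside Vec.∷ p) incl = contradiction (incl zero) λ ()

length-filter-tabulate : ∀ {A : Set} {P : A → Set} (P? : Decidable P) {m} (f : Fin m → A)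
  (p : Subset m) → (∀ i → P (f i) → i ∈ p) → length (filter P? (List.tabulate f)) ≤ ∣ p ∣
length-filter-tabulate P? {zero}  f p                  _    = z≤n
length-filter-tabulate P? {suc m} f (s Vec.∷ p) incl
  with P? (f zero) | s | incl zero
     | length-filter-tabulate P? (f ∘ suc) p (λ i Pi → drop-there (incl (suc i) Pi))
... | yes _  | inside  | _ | ih = s≤s ih
... | yes Pf | outside | q | _  = contradiction (q Pf) λ ()
... | no  _  | inside  | _ | ih = m≤n⇒m≤1+n ih
... | no  _  | outside | _ | ih = ih

-- The product is filtered row by row: a row indexed outside `p` keeps nothing, and every other row
-- keeps at most `d` pairs.
length-filter-cartesianProduct : ∀ {A B : Set} {P : A × B → Set} (P? : Decidable P) {m}
  (f : Fin m → A) (ys : List B) (p : Subset m) {d} →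
  (∀ i → length (filter P? (map (f i ,_) ys)) ≤ d) → (∀ i y → P (f i , y) → i ∈ p) →
  length (filter P? (cartesianProduct (List.tabulate f) ys)) ≤ ∣ p ∣ * d
length-filter-cartesianProduct P? {zero}  f ys p           _     _    = z≤n
length-filter-cartesianProduct P? {suc m} f ys (s Vec.∷ p) {d} row≤d incl = begin
  length (filter P? (row ++ rest))            ≡⟨ cong length (List.filter-++ P? row rest) ⟩
  length (filter P? row ++ filter P? rest)    ≡⟨ List.length-++ (filter P? row) ⟩
  length (filter P? row) + length (filter P? rest)
    ≤⟨ +-monoʳ-≤ _ (length-filter-cartesianProduct P? (f ∘ suc) ys p (row≤d ∘ suc)
                      (λ i y Pi → drop-there (incl (suc i) y Pi))) ⟩
  length (filter P? row) + ∣ p ∣ * d          ≤⟨ head s (incl zero) ⟩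
  ∣ s Vec.∷ p ∣ * d                           ∎
  where
  open ≤-Reasoning
  row  = map (f zero ,_) ys
  rest = cartesianProduct (List.tabulate (f ∘ suc)) ys
  head : ∀ s → (∀ y → _ → zero ∈ s Vec.∷ p) →
         length (filter P? row) + ∣ p ∣ * d ≤ ∣ s Vec.∷ p ∣ * d
  head inside  _ = +-monoˡ-≤ _ (row≤d zero)
  head outside q = ≤-reflexive (cong (λ l → length l + ∣ p ∣ * d)
    (List.filter-none P? (All.map⁺ (All.universal (λ y Py → contradiction (q y Py) λ ()) ys))))

-- Edge counts, degrees and the packing property of complements of covers.

module _ {n : ℕ} (G : Graph n) where

  Adj-sym : ∀ {u v} → Adj G u v → Adj G v u
  Adj-sym {u} {v} = trans (adj-sym G v u)

  Adj⇒≢ : ∀ {u v} → Adj G u v → u ≢ v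
  Adj⇒≢ {u} uv refl = contradiction (trans (sym uv) (adj-irr G u)) λ ()

  ∈-neighbourhood⁺ : ∀ {u v} → Adj G u v → v ∈ neighbourhood G u
  ∈-neighbourhood⁺ {u} {v} uv =
    Vec.lookup⇒[]= v _ (trans (Vec.lookup∘tabulate (adj G u) v) uv)

  ∈-neighbourhood⁻ : ∀ {u v} → v ∈ neighbourhood G u → Adj G u v
  ∈-neighbourhood⁻ {u} {v} v∈ =
    trans (sym (Vec.lookup∘tabulate (adj G u) v)) (Vec.[]=⇒lookup v∈)

  edge∈edges : ∀ {u v} → Adj G u v → ⁅ u ⁆ ∪ ⁅ v ⁆ ∈ˡ edges G
  edge∈edges {u} {v} uv with Fin.<-cmp u v
  ... | tri< u<v _ _ = ∈-map⁺ _ (∈-filter⁺ _ (∈-cartesianProduct⁺ (∈-allFin u) (∈-allFin v)) (u<v , uv))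
  ... | tri≈ _ u≡v _ = contradiction u≡v (Adj⇒≢ uv)
  ... | tri> _ _ v<u = subst (_∈ˡ edges G) (∪-comm ⁅ v ⁆ ⁅ u ⁆)
    (∈-map⁺ _ (∈-filter⁺ _ (∈-cartesianProduct⁺ (∈-allFin v) (∈-allFin u)) (v<u , Adj-sym uv)))

  -- Each edge is listed once, in the row of its smaller end, and the row of `u` holds at most
  -- `degree G u` edges. Hence `p` only has to contain the smaller ends.
  size≤ : ∀ p {d} → (∀ u → degree G u ≤ d) → (∀ u v → u Fin.< v → Adj G u v → u ∈ p) →
          size G ≤ ∣ p ∣ * d
  size≤ p {d} deg≤d incl =
    ≤-trans (≤-reflexive (List.length-map _ (filter P? (cartesianProduct (allFin n) (allFin n)))))
      (length-filter-cartesianProduct P? id (allFin n) p row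
        (λ u v (u<v , uv) → incl u v u<v uv))
    where
    P? = λ ((u , v) : Fin n × Fin n) → (u Fin.<? v) ×-dec (adj G u v Bool.≟ true)
    row : ∀ u → length (filter P? (map (u ,_) (allFin n))) ≤ d
    row u rewrite List.map-tabulate {n = n} id (u ,_) = ≤-trans
      (length-filter-tabulate P? (u ,_) (neighbourhood G u) (λ v (_ , uv) → ∈-neighbourhood⁺ uv))
      (deg≤d u)

  maxDegree≡ : ∀ {d} r → (∀ u → degree G u ≤ d) → d ≤ degree G r → maxDegree G ≡ d
  maxDegree≡ r deg≤d d≤deg = ≤-antisym
    (max≤v⁺ {xs = map (degree G) (allFin n)} z≤n (All.map⁺ (All.universal deg≤d (allFin n))))
    (v≤max⁺ 0 (map (degree G) (allFin n))
      (inj₂ (Any.map (λ { refl → d≤deg }) (∈-map⁺ (degree G) (∈-allFin r)))))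

  CommonNeighbour : Fin n → Fin n → Set
  CommonNeighbour u v = ∃[ w ] Adj G u w × Adj G v w

  -- The complement of an identifying vertex cover is a 2-packing: if uw and vw
  -- are edges with u, v ∉ T, then both meet T in the same subset of {w}.
  commonNeighbour⇒≡ : ∀ {T u v} → IdentifyingVertexCover G T → u ∉ T → v ∉ T →
                      CommonNeighbour u v → u ≡ v
  commonNeighbour⇒≡ {T} {u} {v} ivc u∉T v∉T (w , uw , vw) with u Fin.≟ v
  ... | yes u≡v = u≡v
  ... | no  u≢v = contradiction (⊆-antisym (sub u∉T) (sub v∉T))
                    (distinct (edge∈edges uw) (edge∈edges vw) e≢f)
    where
    open IdentifyingVertexCover ivc

    w-only : ∀ {u x} → u ∉ T → x ∈ (⁅ u ⁆ ∪ ⁅ w ⁆) ∩ T → x ≡ w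
    w-only {u} u∉T x∈ with x∈p∩q⁻ (⁅ u ⁆ ∪ ⁅ w ⁆) T x∈
    ... | x∈e , x∈T with x∈p∪q⁻ ⁅ u ⁆ ⁅ w ⁆ x∈e
    ...   | inj₁ x∈u = contradiction (subst (_∈ T) (x∈⁅y⁆⇒x≡y u x∈u) x∈T) u∉T
    ...   | inj₂ x∈w = x∈⁅y⁆⇒x≡y w x∈w

    sub : ∀ {u v} → u ∉ T → (⁅ u ⁆ ∪ ⁅ w ⁆) ∩ T ⊆ (⁅ v ⁆ ∪ ⁅ w ⁆) ∩ T
    sub u∉T x∈ with w-only u∉T x∈
    ... | refl = x∈p∩q⁺ (x∈p∪q⁺ (inj₂ (x∈⁅x⁆ w)) , proj₂ (x∈p∩q⁻ _ T x∈))

    e≢f : ⁅ u ⁆ ∪ ⁅ w ⁆ ≢ ⁅ v ⁆ ∪ ⁅ w ⁆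
    e≢f eq with x∈p∪q⁻ ⁅ v ⁆ ⁅ w ⁆ (subst (u ∈_) eq (x∈p∪q⁺ (inj₁ (x∈⁅x⁆ u))))
    ... | inj₁ u∈v = u≢v (x∈⁅y⁆⇒x≡y v u∈v)
    ... | inj₂ u∈w = Adj⇒≢ uw (x∈⁅y⁆⇒x≡y w u∈w)

  τD≤n : τD G ≤ n
  τD≤n = ≤-trans (proj₂ (proj₂ (minimumIVC G)) ⊤ (IVC-⊤ G)) (∣p∣≤n {n} ⊤)

  module _ (r : Fin n)
    (common : ∀ {u v} → ¬ Adj G r u → ¬ Adj G r v → CommonNeighbour u v) where

    -- Take a minimum cover `T`. Any two neighbours of `r` share the neighbour `r`, and any two
    -- non-neighbours share one by `common`, so each of the two classes has at most one vertex
    -- outside `T`.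
    n≤τD+2 : n ≤ τD G + 2
    n≤τD+2 with minimumIVC G
    ... | k , (T , ivc , refl) , _ = begin
      n                   ≤⟨ m≤n+m∸n n ∣ T ∣ ⟩
      ∣ T ∣ + (n ∸ ∣ T ∣) ≡⟨ cong (_+_ ∣ T ∣) (∣∁p∣≡n∸∣p∣ T) ⟨
      ∣ T ∣ + ∣ ∁ T ∣     ≤⟨ +-monoʳ-≤ ∣ T ∣ (∣p∣≤∣p∩q∣+∣p∩∁q∣ (∁ T) N) ⟩
      ∣ T ∣ + (∣ ∁ T ∩ N ∣ + ∣ ∁ T ∩ ∁ N ∣)
        ≤⟨ +-monoʳ-≤ ∣ T ∣ (+-mono-≤ (subsingleton⇒∣p∣≤1 _ near) (subsingleton⇒∣p∣≤1 _ far)) ⟩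
      ∣ T ∣ + 2           ∎
      where
      open ≤-Reasoning
      N = neighbourhood G r

      near : ∀ {u v} → u ∈ ∁ T ∩ N → v ∈ ∁ T ∩ N → u ≡ v
      near u∈ v∈ with x∈p∩q⁻ (∁ T) N u∈ | x∈p∩q⁻ (∁ T) N v∈
      ... | u∈∁T , u∈N | v∈∁T , v∈N =
        commonNeighbour⇒≡ ivc (x∈∁p⇒x∉p u∈∁T) (x∈∁p⇒x∉p v∈∁T)
          (r , Adj-sym (∈-neighbourhood⁻ u∈N) , Adj-sym (∈-neighbourhood⁻ v∈N))

      far : ∀ {u v} → u ∈ ∁ T ∩ ∁ N → v ∈ ∁ T ∩ ∁ N → u ≡ v
      far u∈ v∈ with x∈p∩q⁻ (∁ T) (∁ N) u∈ | x∈p∩q⁻ (∁ T) (∁ N) v∈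
      ... | u∈∁T , u∈∁N | v∈∁T , v∈∁N =
        commonNeighbour⇒≡ ivc (x∈∁p⇒x∉p u∈∁T) (x∈∁p⇒x∉p v∈∁T)
          (common (x∈∁p⇒x∉p u∈∁N ∘ ∈-neighbourhood⁺) (x∈∁p⇒x∉p v∈∁N ∘ ∈-neighbourhood⁺))

    commonNeighbour⇒Connected : Connected G
    commonNeighbour⇒Connected =
      Fin.nonZeroIndex r , λ u v → to u ◅◅ reverse Adj-sym (to v)
      where
      to : ∀ u → Star (Adj G) u r
      to u with adj G r u Bool.≟ true
      ... | yes ru = Adj-sym ru ◅ ε
      -- As `r` is not adjacent to itself, `common` applies to the pair `u`, `r` and yields a path
      -- of length two.
      ... | no ¬ru with common ¬ru (λ rr → Adj⇒≢ rr refl)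
      ...   | w , uw , rw = uw ◅ Adj-sym rw ◅ ε

-- Bipartite graphs given by an incidence relation.

bipartite : ∀ {a b} → (Fin a → Fin b → Bool) → Graph (a + b)
bipartite {a} {b} inc = record
  { adj     = λ u v → adj′ (splitAt a u) (splitAt a v)
  ; adj-sym = λ u v → sym′ (splitAt a u) (splitAt a v)
  ; adj-irr = λ u → irr′ (splitAt a u)
  }
  where
  adj′ : Fin a ⊎ Fin b → Fin a ⊎ Fin b → Bool
  adj′ (inj₁ i) (inj₂ j) = inc i j
  adj′ (inj₂ j) (inj₁ i) = inc i j
  adj′ (inj₁ _) (inj₁ _) = false
  adj′ (inj₂ _) (inj₂ _) = false
  sym′ : ∀ x y → adj′ x y ≡ adj′ y x
  sym′ (inj₁ i) (inj₂ j) = refl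
  sym′ (inj₂ j) (inj₁ i) = refl
  sym′ (inj₁ _) (inj₁ _) = refl
  sym′ (inj₂ _) (inj₂ _) = refl
  irr′ : ∀ x → adj′ x x ≡ false
  irr′ (inj₁ _) = refl
  irr′ (inj₂ _) = refl

data Side a b : Fin (a + b) → Set where
  left  : ∀ i → Side a b (i ↑ˡ b)
  right : ∀ j → Side a b (a ↑ʳ j)

side : ∀ a {b} u → Side a b u
side a {b} u with splitAt a u | Fin.join-splitAt a b u
... | inj₁ i | refl = left i
... | inj₂ j | refl = right j

module _ {a b : ℕ} (inc : Fin a → Fin b → Bool) where
  private G = bipartite inc

  Adj-left-right : ∀ i j → adj G (i ↑ˡ b) (a ↑ʳ j) ≡ inc i j
  Adj-left-right i j rewrite Fin.splitAt-↑ˡ a i b | Fin.splitAt-↑ʳ a b j = refl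

  ¬Adj-left-left : ∀ i i′ → ¬ Adj G (i ↑ˡ b) (i′ ↑ˡ b)
  ¬Adj-left-left i i′ rewrite Fin.splitAt-↑ˡ a i b | Fin.splitAt-↑ˡ a i′ b = λ ()

  ¬Adj-right-right : ∀ j j′ → ¬ Adj G (a ↑ʳ j) (a ↑ʳ j′)
  ¬Adj-right-right j j′ rewrite Fin.splitAt-↑ʳ a b j | Fin.splitAt-↑ʳ a b j′ = λ ()

  degree-left≤ : ∀ i xs → (∀ {j} → inc i j ≡ true → j ∈ˡ xs) → degree G (i ↑ˡ b) ≤ length xs
  degree-left≤ i xs incl = ≤-trans
    (p⊆list⇒∣p∣≤length _ (map (a ↑ʳ_) xs) (λ v∈ → cover _ (side a _) (∈-neighbourhood⁻ G v∈)))
    (≤-reflexive (List.length-map (a ↑ʳ_) xs))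
    where
    cover : ∀ v → Side a b v → Adj G (i ↑ˡ b) v → v ∈ˡ map (a ↑ʳ_) xs
    cover _ (left i′) uv = contradiction uv (¬Adj-left-left i i′)
    cover _ (right j) uv = ∈-map⁺ (a ↑ʳ_) (incl (trans (sym (Adj-left-right i j)) uv))

  degree-right≤ : ∀ j → degree G (a ↑ʳ j) ≤ a
  degree-right≤ j = ≤-trans
    (p⊆list⇒∣p∣≤length _ (map (_↑ˡ b) (allFin a)) (λ v∈ → cover _ (side a _) (∈-neighbourhood⁻ G v∈)))
    (≤-reflexive (trans (List.length-map (_↑ˡ b) (allFin a)) (List.length-tabulate id)))
    where
    cover : ∀ v → Side a b v → Adj G (a ↑ʳ j) v → v ∈ˡ map (_↑ˡ b) (allFin a)
    cover _ (left i)   uv = ∈-map⁺ (_↑ˡ b) (∈-allFin i)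
    cover _ (right j′) uv = contradiction uv (¬Adj-right-right j j′)

-- The graph of hubs, blocks and a root.

module _ {Δ k s : ℕ} (ends : Fin Δ → Fin k × Fin k) where

  -- The left side consists of the hubs. On the right, `zero` is the root and `suc p` is the point
  -- `p`, lying in block `quotient s p`; hub `h` is joined to the root and to all points of the two
  -- blocks `ends h`.
  incidence : Fin Δ → Fin (suc (k * s)) → Bool
  incidence h zero    = true
  incidence h (suc p) = does (quotient s p Fin.≟ proj₁ (ends h)) ∨ does (quotient s p Fin.≟ proj₂ (ends h))

  blockGraph : Graph (Δ + suc (k * s))
  blockGraph = bipartite incidence

  private
    G = blockGraph
    root : Fin (Δ + suc (k * s))
    root = Δ ↑ʳ zero

    Adj-root : ∀ h → Adj G root (h ↑ˡ suc (k * s))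
    Adj-root h = Adj-sym G (Adj-left-right incidence h zero)

    block : Fin k → List (Fin (suc (k * s)))
    block i = map (λ x → suc (combine i x)) (allFin s)

    length-block : ∀ i → length (block i) ≡ s
    length-block i = trans (List.length-map _ (allFin s)) (List.length-tabulate id)

    ∈-block : ∀ p → suc p ∈ˡ block (quotient s p)
    ∈-block p = subst (λ q → suc q ∈ˡ block (quotient s p)) (Fin.combine-remQuot {k} s p)
      (∈-map⁺ _ (∈-allFin (proj₂ (remQuot {k} s p))))

    incident : ∀ h → List (Fin (suc (k * s)))
    incident h = zero ∷ block (proj₁ (ends h)) ++ block (proj₂ (ends h))

    ∈-incident : ∀ h {j} → incidence h j ≡ true → j ∈ˡ incident h
    ∈-incident h {zero}  _ = here refl
    ∈-incident h {suc p} eq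
      with quotient s p Fin.≟ proj₁ (ends h) | quotient s p Fin.≟ proj₂ (ends h)
    ... | yes e | _     = there (∈-++⁺ˡ (subst (λ i → suc p ∈ˡ block i) e (∈-block p)))
    ... | no  _ | yes e = there (∈-++⁺ʳ (block (proj₁ (ends h)))
                                  (subst (λ i → suc p ∈ˡ block i) e (∈-block p)))

  -- A hub sees the root and at most two blocks of `s` points; a vertex on the right sees only hubs,
  -- of which there are `Δ`.
  blockGraph-degree≤ : suc (s + s) ≤ Δ → ∀ u → degree G u ≤ Δ
  blockGraph-degree≤ 2s<Δ u with side Δ u
  ... | right j = degree-right≤ incidence j
  ... | left  h = ≤-trans (degree-left≤ incidence h (incident h) (∈-incident h))
    (≤-trans (≤-reflexive (cong suc (trans (List.length-++ (block (proj₁ (ends h))))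
      (cong₂ _+_ (length-block _) (length-block _))))) 2s<Δ)

  blockGraph-maxDegree : suc (s + s) ≤ Δ → maxDegree G ≡ Δ
  blockGraph-maxDegree 2s<Δ = maxDegree≡ G root (blockGraph-degree≤ 2s<Δ)
    (prefix⊆p⇒a≤∣p∣ Δ _ (λ h → ∈-neighbourhood⁺ G (Adj-root h)))

  -- Hubs are numbered first and the graph is bipartite, so the smaller end of every edge is a hub.
  -- The hubs form the neighbourhood of the root, which has at most `Δ` elements, each of degree at
  -- most `Δ`.
  blockGraph-size : suc (s + s) ≤ Δ → size G ≤ Δ * Δ
  blockGraph-size 2s<Δ = ≤-trans
    (size≤ G (neighbourhood G root) (blockGraph-degree≤ 2s<Δ) hub)
    (*-monoˡ-≤ Δ (degree-right≤ incidence zero))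
    where
    hub : ∀ u v → u Fin.< v → Adj G u v → u ∈ neighbourhood G root
    hub u v u<v uv with side Δ u | side Δ v
    ... | left h   | _        = ∈-neighbourhood⁺ G (Adj-root h)
    ... | right j  | right j′ = contradiction uv (¬Adj-right-right incidence j j′)
    ... | right j  | left h   = contradiction u<v (<-asym v<u)
      where
      v<u : h ↑ˡ suc (k * s) Fin.< Δ ↑ʳ j
      v<u rewrite Fin.toℕ-↑ˡ h (suc (k * s)) | Fin.toℕ-↑ʳ Δ j = <-≤-trans (Fin.toℕ<n h) (m≤m+n Δ _)

  module _ (i₀ : Fin k) (ends-surjective : ∀ i j → ∃[ h ] ends h ≡ (i , j)) where

    private
      incidence₁ : ∀ {h} p {j} → ends h ≡ (quotient s p , j) → incidence h (suc p) ≡ true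
      incidence₁ {h} p eq
        rewrite dec-true (quotient s p Fin.≟ proj₁ (ends h)) (sym (cong proj₁ eq)) = refl

      incidence₂ : ∀ {h} p {i} → ends h ≡ (i , quotient s p) → incidence h (suc p) ≡ true
      incidence₂ {h} p eq
        rewrite dec-true (quotient s p Fin.≟ proj₂ (ends h)) (sym (cong proj₂ eq)) = Bool.∨-zeroʳ _

      commonHub : ∀ j j′ → ∃[ h ] incidence h j ≡ true × incidence h j′ ≡ true
      -- The root is joined to every hub, so `i₀` stands in wherever the root has no block to name.
      commonHub zero    zero     = proj₁ (ends-surjective i₀ i₀) , refl , refl
      commonHub zero    (suc q)  with h , eq ← ends-surjective i₀ (quotient s q) =
        h , refl , incidence₂ q eq
      commonHub (suc p) zero     with h , eq ← ends-surjective (quotient s p) i₀ =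
        h , incidence₁ p eq , refl
      commonHub (suc p) (suc q)  with h , eq ← ends-surjective (quotient s p) (quotient s q) =
        h , incidence₁ p eq , incidence₂ q eq

    blockGraph-commonNeighbour : ∀ {u v} → ¬ Adj G root u → ¬ Adj G root v →
                                 CommonNeighbour G u v
    blockGraph-commonNeighbour {u} {v} ¬ru ¬rv with side Δ u | side Δ v
    ... | left h  | _        = contradiction (Adj-root h) ¬ru
    ... | right j | left h   = contradiction (Adj-root h) ¬rv
    ... | right j | right j′ with h , hj , hj′ ← commonHub j j′ =
      h ↑ˡ suc (k * s) , Adj-sym G (trans (Adj-left-right incidence h j) hj)
                       , Adj-sym G (trans (Adj-left-right incidence h j′) hj′)

    blockGraph-connected : Connected G
    blockGraph-connected = commonNeighbour⇒Connected G root blockGraph-commonNeighbour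

    blockGraph-order : Δ + suc (k * s) ≤ τD G + 2
    blockGraph-order = n≤τD+2 G root blockGraph-commonNeighbour

-- Choice of the parameters and estimates for the order.

pairEnumeration : ∀ {k Δ} → Fin k → k * k ≤ Δ →
  Σ (Fin Δ → Fin k × Fin k) λ ends → ∀ i j → ∃[ h ] ends h ≡ (i , j)
pairEnumeration {k} {Δ} i₀ k²≤Δ with m≤n⇒∃[o]m+o≡n k²≤Δ
... | r , refl = ends , λ i j → combine i j ↑ˡ r , ends-combine i j
  where
  ends : Fin (k * k + r) → Fin k × Fin k
  -- Hubs beyond the first `k * k` receive the default pair; they bring the number of hubs, hence
  -- the degree of the root, to exactly `Δ`.
  ends h = [ remQuot k , (λ _ → i₀ , i₀) ]′ (splitAt (k * k) h)
  ends-combine : ∀ i j → ends (combine i j ↑ˡ r) ≡ (i , j)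
  ends-combine i j rewrite Fin.splitAt-↑ˡ (k * k) (combine i j) r = Fin.remQuot-combine i j

squareRoot : ∀ n → ∃[ k ] k * k ≤ n × n < suc k * suc k
squareRoot zero    = 0 , z≤n , s≤s z≤n
squareRoot (suc n) with squareRoot n
... | k , k²≤n , n<k+1² with suc n <? suc k * suc k
...   | yes lt = k , m≤n⇒m≤1+n k²≤n , lt
...   | no ¬lt = suc k , ≮⇒≥ ¬lt , ≤-<-trans n<k+1² (*-mono-< (n<1+n (suc k)) (n<1+n (suc k)))

half : ∀ n → ∃[ s ] s + s ≤ n × n ≤ suc (s + s)
half zero          = 0 , z≤n , z≤n
half (suc zero)    = 0 , z≤n , ≤-refl
half (suc (suc n)) with s , lo , hi ← half n =
  suc s , s≤s (subst (_≤ suc n) (sym (+-suc s s)) (s≤s lo))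
        , s≤s (s≤s (subst (n ≤_) (sym (+-suc s s)) hi))

record Sparse Δ k : Set where
  field
    {order}   : ℕ
    graph     : Graph order
    connected : Connected graph
    maxDeg    : maxDegree graph ≡ Δ
    size≤Δ²   : size graph ≤ Δ * Δ
    order≤    : order ≤ τD graph + 2
    order≥    : Δ * suc k ≤ 2 * order

-- With `Δ = suc d`, the block size `s` is `d / 2` rounded down, the largest for which a hub of
-- degree `1 + 2 * s` stays within `Δ`. The bound `k * k ≤ Δ` leaves a hub for every ordered pair of
-- blocks.
sparse : ∀ {Δ k} → 2 ≤ k → k * k ≤ Δ → Sparse Δ k
sparse {k = suc zero}           (s≤s ())
sparse {zero} {suc (suc _)} _ ()
sparse {suc d} {k@(suc (suc _))} 2≤k k²≤Δ
  with ends , surjective ← pairEnumeration {k} zero k²≤Δ | s , lo , hi ← half d = record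
  { graph     = blockGraph {s = s} ends
  ; connected = blockGraph-connected ends zero surjective
  ; maxDeg    = blockGraph-maxDegree ends (s≤s lo)
  ; size≤Δ²   = blockGraph-size ends (s≤s lo)
  ; order≤    = blockGraph-order ends zero surjective
  ; order≥    = begin
      suc d * suc k                 ≡⟨ *-suc (suc d) k ⟩
      suc d + suc d * k             ≤⟨ +-monoʳ-≤ (suc d) (*-monoˡ-≤ k (s≤s hi)) ⟩
      suc d + suc (suc (s + s)) * k ≡⟨ reorder (suc d) k s ⟩
      -- Rounding `s` down costs `2 * k ≤ k * k ≤ Δ`, which the second copy of the hubs in
      -- `2 * order` pays for.
      suc d + 2 * k + 2 * (k * s)   ≤⟨ +-monoˡ-≤ (2 * (k * s)) (+-monoʳ-≤ (suc d)
                                         (≤-trans (*-monoˡ-≤ k 2≤k) k²≤Δ)) ⟩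
      suc d + suc d + 2 * (k * s)   ≤⟨ m≤n+m _ 2 ⟩
      2 + (suc d + suc d + 2 * (k * s)) ≡⟨ collect (suc d) (k * s) ⟩
      2 * (suc d + suc (k * s))     ∎
  }
  where
  open ≤-Reasoning
  reorder : ∀ a b c → a + (2 + (c + c)) * b ≡ a + 2 * b + 2 * (b * c)
  reorder = solve-∀
  collect : ∀ a b → 2 + (a + a + 2 * b) ≡ 2 * (a + (1 + b))
  collect = solve-∀

-- This is `2 / (3 * n) ≤ Δ^(-4/3)` cubed and cleared of denominators. Cube `Δ * suc k ≤ 2 * n`,
-- then bound one factor `suc k` below by 3 and the square of the other two by `Δ`; the constants
-- fit because `64 ≤ 81 = 27 * 3`.
8Δ⁴≤[3n]³ : ∀ {Δ k n} → 2 ≤ k → Δ ≤ suc k * suc k → Δ * suc k ≤ 2 * n →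
            8 * Δ ^ 4 ≤ 3 * n * (3 * n) * (3 * n)
8Δ⁴≤[3n]³ {Δ} {k} {n} 2≤k Δ≤ ≤2n = *-cancelˡ-≤ 8 (begin
  8 * (8 * Δ ^ 4)                        ≡⟨ e₁ Δ ⟩
  64 * (Δ * Δ * Δ * Δ)                   ≤⟨ *-monoˡ-≤ (Δ * Δ * Δ * Δ) (m≤m+n 64 17) ⟩
  27 * 3 * (Δ * Δ * Δ * Δ)               ≤⟨ *-mono-≤ (*-monoʳ-≤ 27 (s≤s 2≤k))
                                              (*-monoʳ-≤ (Δ * Δ * Δ) Δ≤) ⟩
  27 * suc k * (Δ * Δ * Δ * (suc k * suc k)) ≡⟨ e₂ Δ (suc k) ⟩
  27 * (Δ * suc k * (Δ * suc k) * (Δ * suc k)) ≤⟨ *-monoʳ-≤ 27 (*-mono-≤ (*-mono-≤ ≤2n ≤2n) ≤2n) ⟩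
  27 * (2 * n * (2 * n) * (2 * n))       ≡⟨ e₃ n ⟩
  8 * (3 * n * (3 * n) * (3 * n))        ∎)
  where
  open ≤-Reasoning
  e₁ : ∀ a → 8 * (8 * (a * (a * (a * (a * 1))))) ≡ 64 * (a * a * a * a)
  e₁ = solve-∀
  e₂ : ∀ a b → 27 * b * (a * a * a * (b * b)) ≡ 27 * (a * b * (a * b) * (a * b))
  e₂ = solve-∀
  e₃ : ∀ a → 27 * (2 * a * (2 * a) * (2 * a)) ≡ 8 * (3 * a * (3 * a) * (3 * a))
  e₃ = solve-∀

-- Arithmetic of fractions and the two bounds on the normalised excess.

-- `_/_` reduces to lowest terms, so this and the next two rules pass through unnormalised
-- rationals, where numerators and denominators stay visible.
/-mono-≤ : ∀ a b c d .{{_ : NonZero b}} .{{_ : NonZero d}} → a * d ≤ c * b → + a / b ℚ.≤ + c / d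
/-mono-≤ a (suc b) c (suc d) ad≤cb = ℚ.toℚᵘ-cancel-≤
  (ℚᵘ.≤-respˡ-≃ (ℚᵘ.≃-sym (ℚ.toℚᵘ-fromℚᵘ (ℚᵘ.mkℚᵘ (+ a) b)))
  (ℚᵘ.≤-respʳ-≃ (ℚᵘ.≃-sym (ℚ.toℚᵘ-fromℚᵘ (ℚᵘ.mkℚᵘ (+ c) d)))
  (ℚᵘ.*≤* (subst₂ ℤ._≤_ (ℤ.pos-* a (suc d)) (ℤ.pos-* c (suc b)) (ℤ.+≤+ ad≤cb)))))

/-*-/ : ∀ a b c d .{{_ : NonZero b}} .{{_ : NonZero d}} →
        (+ a / b) ℚ.* (+ c / d) ≡ _/_ (+ (a * c)) (b * d) {{m*n≢0 b d}}
/-*-/ a (suc b) c (suc d) = ℚ.toℚᵘ-injective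
  (ℚᵘ.≃-trans (ℚ.toℚᵘ-homo-* (+ a / suc b) (+ c / suc d))
  (ℚᵘ.≃-trans (ℚᵘ.*-cong (ℚ.toℚᵘ-fromℚᵘ (ℚᵘ.mkℚᵘ (+ a) b)) (ℚ.toℚᵘ-fromℚᵘ (ℚᵘ.mkℚᵘ (+ c) d)))
  (ℚᵘ.≃-trans (ℚᵘ.≃-reflexive (cong (λ i → ℚᵘ.mkℚᵘ i _) (sym (ℤ.pos-* a c))))
  (ℚᵘ.≃-sym (ℚ.toℚᵘ-fromℚᵘ (ℚᵘ.mkℚᵘ (+ (a * c)) (d + b * suc d)))))))

/-+-/ : ∀ a b c d .{{_ : NonZero b}} .{{_ : NonZero d}} →
        (+ a / b) ℚ.+ (+ c / d) ≡ _/_ (+ (a * d + c * b)) (b * d) {{m*n≢0 b d}}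
/-+-/ a (suc b) c (suc d) = ℚ.toℚᵘ-injective
  (ℚᵘ.≃-trans (ℚ.toℚᵘ-homo-+ (+ a / suc b) (+ c / suc d))
  (ℚᵘ.≃-trans (ℚᵘ.+-cong (ℚ.toℚᵘ-fromℚᵘ (ℚᵘ.mkℚᵘ (+ a) b)) (ℚ.toℚᵘ-fromℚᵘ (ℚᵘ.mkℚᵘ (+ c) d)))
  (ℚᵘ.≃-trans (ℚᵘ.≃-reflexive (cong (λ i → ℚᵘ.mkℚᵘ i _)
    (cong₂ ℤ._+_ (sym (ℤ.pos-* a (suc d))) (sym (ℤ.pos-* c (suc b))))))
  (ℚᵘ.≃-sym (ℚ.toℚᵘ-fromℚᵘ (ℚᵘ.mkℚᵘ (+ (a * suc d + c * suc b)) (d + b * suc d)))))))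

p+s≤r+q⇒p-q≤r-s : ∀ {p q r s} → p ℚ.+ s ℚ.≤ r ℚ.+ q → p ℚ.- q ℚ.≤ r ℚ.- s
p+s≤r+q⇒p-q≤r-s {p} {q} {r} {s} le = subst₂ ℚ._≤_
  (solve 3 (λ p q s → p :+ s :+ (:- q :+ :- s) := p :- q) refl p q s)
  (solve 3 (λ r q s → r :+ q :+ (:- q :+ :- s) := r :- s) refl r q s)
  (ℚ.+-monoˡ-≤ (ℚ.- q ℚ.+ ℚ.- s) le)
  where open +-*-Solver

-- normalisedExcess G is excess (τD G) (maxDegree G) (size G) n definitionally.
excess : (τ Δ m n : ℕ) .{{_ : NonZero n}} → ℚ
excess τ Δ m n = (+ τ / 1 ℚ.- + (Δ * (Δ ∸ 1) * n + 2 * m) / (1 + Δ ^ 2)) ℚ.* (+ 1 / n)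

excess≡ : ∀ τ A D n .{{_ : NonZero D}} .{{_ : NonZero n}} →
  (+ τ / 1 ℚ.- + A / D) ℚ.* (+ 1 / n) ≡ + τ / n ℚ.- _/_ (+ A) (D * n) {{m*n≢0 D n}}
excess≡ τ A D n = begin
  (t ℚ.- b) ℚ.* x          ≡⟨ ℚ.*-distribʳ-+ x t (ℚ.- b) ⟩
  t ℚ.* x ℚ.+ ℚ.- b ℚ.* x  ≡⟨ cong (t ℚ.* x ℚ.+_) (ℚ.neg-distribˡ-* b x) ⟨
  t ℚ.* x ℚ.- b ℚ.* x      ≡⟨ cong₂ ℚ._-_
                                (trans (/-*-/ τ 1 1 n) (ℚ./-cong (cong +_ (*-identityʳ τ)) (*-identityˡ n)))
                                (trans (/-*-/ A D 1 n) (ℚ./-cong (cong +_ (*-identityʳ A)) refl)) ⟩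
  _                        ∎
  where
  open ≡-Reasoning
  t = + τ / 1
  b = + A / D
  x = + 1 / n
  instance
    _ = m*n≢0 1 n
    _ = m*n≢0 D n

-- Of the loss `4 / n`, one half comes from `τ ≥ n - 2` and the other from `2 * m / (Δ² + 1) ≤ 2`.
-- What remains is `1 - Δ (Δ - 1) / (Δ² + 1) = (Δ + 1) / (Δ² + 1)`, which is at least `1 / Δ`.
excess-lower : ∀ {τ Δ m n} .{{_ : NonZero Δ}} .{{_ : NonZero n}} → m ≤ Δ * Δ → n ≤ τ + 2 →
  + 1 / Δ ℚ.- + 4 / n ℚ.≤ excess τ Δ m n
excess-lower {τ} {Δ} {m} {n} m≤ n≤ = ℚ.≤-trans
  (p+s≤r+q⇒p-q≤r-s {+ 1 / Δ} {+ 4 / n} {+ τ / n} {+ A / (D * n)}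
    (subst₂ ℚ._≤_ (sym (/-+-/ 1 Δ A (D * n))) (sym (/-+-/ τ n 4 n))
    (/-mono-≤ (1 * (D * n) + A * Δ) (Δ * (D * n)) (τ * n + 4 * n) (n * n) (begin
      (1 * (D * n) + A * Δ) * (n * n)    ≤⟨ *-monoˡ-≤ (n * n) (core Δ m≤) ⟩
      (τ + 4) * (Δ * D) * (n * n)        ≡⟨ e τ Δ D n ⟩
      (τ * n + 4 * n) * (Δ * (D * n))    ∎))))
  (ℚ.≤-reflexive (sym (excess≡ τ A D n)))
  where
  open ≤-Reasoning
  A = Δ * (Δ ∸ 1) * n + 2 * m
  D = 1 + Δ ^ 2
  instance
    _ = m*n≢0 D n
    _ = m*n≢0 n n
    _ = m*n≢0 Δ (D * n)
  e : ∀ t a d n → (t + 4) * (a * d) * (n * n) ≡ (t * n + 4 * n) * (a * (d * n))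
  e = solve-∀
  core : ∀ Δ .{{_ : NonZero Δ}} → m ≤ Δ * Δ →
    1 * ((1 + Δ ^ 2) * n) + (Δ * (Δ ∸ 1) * n + 2 * m) * Δ ≤ (τ + 4) * (Δ * (1 + Δ ^ 2))
  core Δ@(suc d) m≤ = begin
    1 * ((1 + Δ ^ 2) * n) + (Δ * d * n + 2 * m) * Δ
      ≤⟨ +-monoʳ-≤ (1 * ((1 + Δ ^ 2) * n)) (*-monoˡ-≤ Δ (+-monoʳ-≤ (Δ * d * n) (*-monoʳ-≤ 2 m≤))) ⟩
    1 * ((1 + Δ ^ 2) * n) + (Δ * d * n + 2 * (Δ * Δ)) * Δ
      -- The slack: `d = (Δ + 1) * Δ - (Δ² + 1)` per vertex, and `2 * Δ` from
      -- `2 * Δ² ≤ 2 * (1 + Δ²)` multiplied by `Δ`.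
      ≤⟨ m≤m+n _ (d * n + 2 * Δ) ⟩
    1 * ((1 + Δ ^ 2) * n) + (Δ * d * n + 2 * (Δ * Δ)) * Δ + (d * n + 2 * Δ)
      ≡⟨ e′ d n ⟩
    (n + 2) * (Δ * (1 + Δ ^ 2))
      ≤⟨ *-monoˡ-≤ (Δ * (1 + Δ ^ 2)) (≤-trans (+-monoˡ-≤ 2 n≤) (≤-reflexive (+-assoc τ 2 2))) ⟩
    (τ + 4) * (Δ * (1 + Δ ^ 2)) ∎
    where
    e′ : ∀ d n → 1 * ((1 + (1 + d) * ((1 + d) * 1)) * n)
         + ((1 + d) * d * n + 2 * ((1 + d) * (1 + d))) * (1 + d) + (d * n + 2 * (1 + d))
       ≡ (n + 2) * ((1 + d) * (1 + (1 + d) * ((1 + d) * 1)))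
    e′ = solve-∀

-- Dropping the edge term and using `τ ≤ n` leaves `1 - Δ (Δ - 1) / (Δ² + 1)`, which equals the
-- right-hand side.
excess-upper : ∀ {τ Δ m n} .{{_ : NonZero Δ}} .{{_ : NonZero n}} → τ ≤ n →
  excess τ Δ m n ℚ.≤ + (suc Δ) / (1 + Δ ^ 2)
excess-upper {τ} {Δ} {m} {n} τ≤n =
  subst₂ ℚ._≤_ (sym (excess≡ τ A D n)) (ℚ.+-identityʳ (+ suc Δ / D))
  (p+s≤r+q⇒p-q≤r-s {+ τ / n} {+ A / (D * n)} {+ suc Δ / D} {0ℚ}
  (subst₂ ℚ._≤_ (sym (ℚ.+-identityʳ (+ τ / n))) (sym (/-+-/ (suc Δ) D A (D * n)))
    (/-mono-≤ τ n (suc Δ * (D * n) + A * D) (D * (D * n)) (begin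
      τ * (D * (D * n))                ≤⟨ *-monoˡ-≤ (D * (D * n)) τ≤n ⟩
      n * (D * (D * n))                ≡⟨ *-assoc n D (D * n) ⟨
      n * D * (D * n)                  ≤⟨ *-monoˡ-≤ (D * n) (core Δ) ⟩
      (suc Δ * n + A) * (D * n)        ≡⟨ e (suc Δ) A D n ⟩
      (suc Δ * (D * n) + A * D) * n    ∎))))
  where
  open ≤-Reasoning
  A = Δ * (Δ ∸ 1) * n + 2 * m
  D = 1 + Δ ^ 2
  instance
    _ = m*n≢0 D n
    _ = m*n≢0 D (D * n)
  e : ∀ t a d n → (t * n + a) * (d * n) ≡ (t * (d * n) + a * d) * n
  e = solve-∀
  core : ∀ Δ .{{_ : NonZero Δ}} → n * (1 + Δ ^ 2) ≤ suc Δ * n + (Δ * (Δ ∸ 1) * n + 2 * m)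
  core (suc d) = ≤-trans (m≤m+n _ (2 * m)) (≤-reflexive (e′ d n (2 * m)))
    where
    e′ : ∀ d n m → n * (1 + (1 + d) * ((1 + d) * 1)) + m ≡ (2 + d) * n + ((1 + d) * d * n + m)
    e′ = solve-∀

-- Multiples of cuts, and `4 / n` against the cube root.

k*[1/k*q]≡q : ∀ k .{{_ : NonZero k}} q → (+ k / 1) ℚ.* ((+ 1 / k) ℚ.* q) ≡ q
k*[1/k*q]≡q k q = begin
  (+ k / 1) ℚ.* ((+ 1 / k) ℚ.* q)  ≡⟨ ℚ.*-assoc (+ k / 1) (+ 1 / k) q ⟨
  (+ k / 1) ℚ.* (+ 1 / k) ℚ.* q    ≡⟨ cong (ℚ._* q) (trans (/-*-/ k 1 1 k) k/k≡1) ⟩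
  1ℚ ℚ.* q                         ≡⟨ ℚ.*-identityˡ q ⟩
  q                                ∎
  where
  open ≡-Reasoning
  instance _ = m*n≢0 1 k
  k/k≡1 : + (k * 1) / (1 * k) ≡ 1ℚ
  k/k≡1 = ℚ.≤-antisym (/-mono-≤ (k * 1) (1 * k) 1 1 (≤-reflexive (e k)))
                      (/-mono-≤ 1 1 (k * 1) (1 * k) (≤-reflexive (sym (e k))))
    where
    e : ∀ k → k * 1 * 1 ≡ 1 * (1 * k)
    e = solve-∀

-- Divide by `k` a rational strictly between `q` and `k t`. The result is the witness that
-- membership in the cut of `k · x` asks for.
<k*t⇒∃<t : ∀ k .{{_ : NonZero k}} {q t} → q ℚ.< (+ k / 1) ℚ.* t →
           ∃[ p ] p ℚ.< t × q ℚ.< (+ k / 1) ℚ.* p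
<k*t⇒∃<t k {q} {t} q<kt with m , q<m , m<kt ← ℚ.<-dense q<kt =
  (+ 1 / k) ℚ.* m ,
  ℚ.*-cancelˡ-<-nonNeg (+ k / 1) {{ℚ.normalize-nonNeg k 1}}
    (subst (ℚ._< (+ k / 1) ℚ.* t) (sym (k*[1/k*q]≡q k m)) m<kt) ,
  subst (q ℚ.<_) (sym (k*[1/k*q]≡q k m)) q<m

-- The hypotheses encode `k · x ≤ b` and `t ≤ x`. If `b` were below `k t`, it would lie in the cut
-- of `k · x`.
k*t≤upper : ∀ k .{{_ : NonZero k}} x {b t} → ¬ L (k · x) b → (∀ {p} → p ℚ.< t → L x p) →
            (+ k / 1) ℚ.* t ℚ.≤ b
k*t≤upper k x ¬Lb below-t = ℚ.≮⇒≥ λ b<kt → let p , p<t , b<kp = <k*t⇒∃<t k b<kt in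
  ¬Lb (_ , (p , below-t p<t , refl) , b<kp)

p≤q,s≤r⇒p-r≤q-s : ∀ {p q r s} → p ℚ.≤ q → s ℚ.≤ r → p ℚ.- r ℚ.≤ q ℚ.- s
p≤q,s≤r⇒p-r≤q-s p≤q s≤r = ℚ.+-mono-≤ p≤q (ℚ.neg-antimono-≤ s≤r)

p<q,s≤r⇒p-r<q-s : ∀ {p q r s} → p ℚ.< q → s ℚ.≤ r → p ℚ.- r ℚ.< q ℚ.- s
p<q,s≤r⇒p-r<q-s p<q s≤r = ℚ.+-mono-<-≤ p<q (ℚ.neg-antimono-≤ s≤r)

4/n≤6∛ : ∀ {Δ n b} .{{_ : NonZero Δ}} .{{_ : NonZero n}} → 8 * Δ ^ 4 ≤ 3 * n * (3 * n) * (3 * n) →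
         ¬ L (6 · (Δ ^-4/3)) b → + 4 / n ℚ.≤ b
4/n≤6∛ {Δ} {n} {b} cube ¬Lb = ℚ.≤-trans 4/n≤6t
  (k*t≤upper 6 (Δ ^-4/3) ¬Lb (λ p<t → t , t³≤ , p<t))
  where
  instance
    _ = m^n≢0 Δ 4
    _ = m*n≢0 3 n
    _ = m*n≢0 1 (3 * n)
    _ = m*n≢0 (3 * n) (3 * n)
    _ = m*n≢0 (3 * n * (3 * n)) (3 * n)
  -- Chosen so that `6 t = 4 / n`; the hypothesis `cube` then says that `t` is at most the cube root
  -- of `1 / Δ ^ 4`.
  t = + 2 / (3 * n)
  4/n≤6t : + 4 / n ℚ.≤ (+ 6 / 1) ℚ.* t
  4/n≤6t = subst (+ 4 / n ℚ.≤_) (sym (/-*-/ 6 1 2 (3 * n)))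
    (/-mono-≤ 4 n 12 (1 * (3 * n)) (≤-reflexive (e n)))
    where
    e : ∀ n → 4 * (1 * (3 * n)) ≡ 12 * n
    e = solve-∀
  t³≤ : t ℚ.* t ℚ.* t ℚ.≤ + 1 / Δ ^ 4
  t³≤ = subst (ℚ._≤ + 1 / Δ ^ 4)
    (sym (trans (cong (ℚ._* t) (/-*-/ 2 (3 * n) 2 (3 * n))) (/-*-/ 4 (3 * n * (3 * n)) 2 (3 * n))))
    (/-mono-≤ 8 (3 * n * (3 * n) * (3 * n)) 1 (Δ ^ 4)
      (≤-trans cube (≤-reflexive (sym (*-identityˡ _)))))

-- A positive numerator is at least 1, so the denominator of `η` itself serves.
positive⇒1/d≤ : ∀ {η} → 0ℚ ℚ.< η → ∃[ d ] + 1 / suc d ℚ.≤ η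
positive⇒1/d≤ {mkℚ (+ zero) d _}   (ℚ.*<* (ℤ.+<+ ()))
positive⇒1/d≤ {mkℚ -[1+ _ ] d _}   (ℚ.*<* ())
positive⇒1/d≤ {η@(mkℚ +[1+ a ] d _)} _ = d ,
  subst (+ 1 / suc d ℚ.≤_) (ℚ.↥p/↧p≡p η)
    (/-mono-≤ 1 (suc d) (suc a) (suc d) (*-monoˡ-≤ (suc d) {1} {suc a} (s≤s z≤n)))

-- Attained values of the normalised excess.

Excess-≤ : ∀ {Δ q} .{{_ : NonZero Δ}} → Excess Δ q → q ℚ.≤ + suc Δ / (1 + Δ ^ 2)
Excess-≤ {{Δ≢0}} (n , G , (n≢0 , _) , refl , refl) =
  excess-upper {τD G} {maxDegree G} {size G} {n} {{Δ≢0}} {{n≢0}} (τD≤n G)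

-- Keeps `k` beside `n`, since the cube-root estimate and the limit each extract their own lower
-- bound on `n` from `Δ * suc k ≤ 2 * n`.
record LargeExcess Δ .{{_ : NonZero Δ}} : Set where
  field
    k n       : ℕ
    n≢0       : NonZero n
    2≤k       : 2 ≤ k
    Δ<[k+1]²  : Δ < suc k * suc k
    Δ[k+1]≤2n : Δ * suc k ≤ 2 * n
    value     : ℚ
    attained  : Excess Δ value
    value≥    : + 1 / Δ ℚ.- _/_ (+ 4) n {{n≢0}} ℚ.≤ value

abstract
  sparse⇒largeExcess : ∀ {Δ k} .{{_ : NonZero Δ}} → 2 ≤ k → Δ < suc k * suc k → Sparse Δ k →
                       LargeExcess Δ
  sparse⇒largeExcess {{Δ≢0}} 2≤k Δ<[k+1]²
    record { graph = G ; connected = conn@(n≢0 , _) ; maxDeg = refl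
           ; size≤Δ² = size≤ ; order≤ = n≤ ; order≥ = ≥n } = record
    { n≢0       = n≢0
    ; 2≤k       = 2≤k
    ; Δ<[k+1]²  = Δ<[k+1]²
    ; Δ[k+1]≤2n = ≥n
    ; attained  = _ , G , conn , refl , refl
    ; value≥    = excess-lower {τD G} {maxDegree G} {size G} {{Δ≢0}} {{n≢0}} size≤ n≤
    }

  -- Here `k` is the integer square root of `Δ`, and `4 ≤ Δ` forces `2 ≤ k`.
  largeExcess : ∀ Δ .{{_ : NonZero Δ}} → 4 ≤ Δ → LargeExcess Δ
  largeExcess Δ 4≤Δ with k , k²≤Δ , Δ<[k+1]² ← squareRoot Δ =
    sparse⇒largeExcess (2≤k k Δ<[k+1]²) Δ<[k+1]² (sparse (2≤k k Δ<[k+1]²) k²≤Δ)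
    where
    2≤k : ∀ k → Δ < suc k * suc k → 2 ≤ k
    2≤k zero          Δ<1 = contradiction (<-≤-trans Δ<1 (≤-trans (s≤s z≤n) 4≤Δ)) (<-irrefl refl)
    2≤k (suc zero)    Δ<4 = contradiction (<-≤-trans Δ<4 4≤Δ) (<-irrefl refl)
    2≤k (suc (suc k)) _   = s≤s (s≤s z≤n)

-- The lower bound for each `Δ` and the limit.

-- A rational in the cut of the difference is below some `a - b` with `a < 1 / Δ` and `b` at least
-- `6 · (Δ ^-4/3)`, hence at least `4 / n`; so the value attained by one graph exceeds it.
lowerBound : (Δ : ℕ) .{{_ : NonZero Δ}} → 8 ≤ Δ → c Δ ≥ʳ fromℚ (+ 1 / Δ) -ʳ 6 · (Δ ^-4/3)
lowerBound Δ 8≤Δ q (_ , (a , b , a<1/Δ , ¬Lb , refl) , q<a-b) =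
  value , attained , (begin-strict
  q                    <⟨ q<a-b ⟩
  a ℚ.- b              <⟨ p<q,s≤r⇒p-r<q-s a<1/Δ
      (4/n≤6∛ {Δ} {n} (8Δ⁴≤[3n]³ {Δ} {k} {n} 2≤k (<⇒≤ Δ<[k+1]²) Δ[k+1]≤2n) ¬Lb) ⟩
  + 1 / Δ ℚ.- + 4 / n  ≤⟨ value≥ ⟩
  value                ∎)
  where
  open ℚ.≤-Reasoning
  open LargeExcess (largeExcess Δ (≤-trans (m≤m+n 4 4) 8≤Δ))
  instance _ = n≢0

-- For k ≥ (8D)², where 1/D ≤ η, the loss k · 4/n ≤ 8/(√k + 1) and the excess over 1 of
-- k (k + 1)/(k² + 1) are both at most 1/D.
limit : (λ k → k · c k) ⟶ fromℚ 1ℚ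
limit η 0<η = 8 * D * (8 * D) , bounds
  where
  D = suc (proj₁ (positive⇒1/d≤ 0<η))
  1/D≤η : + 1 / D ℚ.≤ η
  1/D≤η = proj₂ (positive⇒1/d≤ 0<η)
  64D²≥D : D ≤ 8 * D * (8 * D)
  64D²≥D = ≤-trans (m≤m*n D (8 * D * 8)) (≤-reflexive (e D))
    where
    e : ∀ D → D * (8 * D * 8) ≡ 8 * D * (8 * D)
    e = solve-∀
  64D²≥4 : 4 ≤ 8 * D * (8 * D)
  64D²≥4 = *-mono-≤ {1} {8 * D} {4} {8 * D} (s≤s z≤n) (≤-trans (m≤m+n 4 4) (m≤m*n 8 D))

  bounds : ∀ k → 8 * D * (8 * D) ≤ k →
           (fromℚ 1ℚ -ʳ fromℚ η ≤ʳ k · c k) × (k · c k -ʳ fromℚ η ≤ʳ fromℚ 1ℚ)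
  bounds zero ()
  bounds k@(suc _) 64D²≤k = lo , hi
    where
    open ℚ.≤-Reasoning
    lo : fromℚ 1ℚ -ʳ fromℚ η ≤ʳ k · c k
    lo q (_ , (a , b , a<1 , b≮η , refl) , q<a-b) =
      let p , p<E , q<kp = <k*t⇒∃<t k q<kE in _ , (p , (E , attained , p<E) , refl) , q<kp
      where
      open LargeExcess (largeExcess k (≤-trans 64D²≥4 64D²≤k))
        renaming (k to r; value to E; Δ<[k+1]² to k<[r+1]²; Δ[k+1]≤2n to k[r+1]≤2n)
      instance
        _ = n≢0
        _ = m*n≢0 1 n
      8D≤r+1 : 8 * D ≤ suc r
      8D≤r+1 = ≮⇒≥ λ r+1<8D → <-irrefl refl
        (<-≤-trans k<[r+1]² (≤-trans (*-mono-≤ (<⇒≤ r+1<8D) (<⇒≤ r+1<8D)) 64D²≤k))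
      -- That is, `k * (4 / n) ≤ 1 / D`, from `2 * n ≥ k * (r + 1) ≥ 8 * k * D`. The unit factors
      -- match the denominators produced by `/-*-/`.
      4kD≤n : k * 4 * D ≤ 1 * (1 * n)
      4kD≤n = *-cancelˡ-≤ 2 (≤-trans (≤-reflexive (e k D))
        (≤-trans (*-monoʳ-≤ k 8D≤r+1) (≤-trans k[r+1]≤2n (≤-reflexive (e′ n)))))
        where
        e : ∀ k D → 2 * (k * 4 * D) ≡ k * (8 * D)
        e = solve-∀
        e′ : ∀ n → 2 * n ≡ 2 * (1 * (1 * n))
        e′ = solve-∀
      k/1 = + k / 1
      k*1/k≡1 : k/1 ℚ.* (+ 1 / k) ≡ 1ℚ
      k*1/k≡1 = trans (cong (k/1 ℚ.*_) (sym (ℚ.*-identityʳ (+ 1 / k)))) (k*[1/k*q]≡q k 1ℚ)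
      q<kE : q ℚ.< k/1 ℚ.* E
      q<kE = begin-strict
        q                                      <⟨ q<a-b ⟩
        a ℚ.- b                                <⟨ p<q,s≤r⇒p-r<q-s a<1 (ℚ.≤-trans 1/D≤η (ℚ.≮⇒≥ b≮η)) ⟩
        1ℚ ℚ.- + 1 / D                         ≤⟨ p≤q,s≤r⇒p-r≤q-s {1ℚ} ℚ.≤-refl
                                                    (/-mono-≤ (k * 4) (1 * n) 1 D 4kD≤n) ⟩
        1ℚ ℚ.- + (k * 4) / (1 * n)             ≡⟨ cong₂ ℚ._-_ (sym k*1/k≡1) (sym (/-*-/ k 1 4 n)) ⟩
        k/1 ℚ.* (+ 1 / k) ℚ.- k/1 ℚ.* (+ 4 / n) ≡⟨ cong (k/1 ℚ.* (+ 1 / k) ℚ.+_) (ℚ.neg-distribʳ-* k/1 (+ 4 / n)) ⟩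
        k/1 ℚ.* (+ 1 / k) ℚ.+ k/1 ℚ.* (ℚ.- (+ 4 / n)) ≡⟨ ℚ.*-distribˡ-+ k/1 (+ 1 / k) (ℚ.- (+ 4 / n)) ⟨
        k/1 ℚ.* (+ 1 / k ℚ.- + 4 / n)          ≤⟨ ℚ.*-monoˡ-≤-nonNeg k/1 {{ℚ.normalize-nonNeg k 1}} value≥ ⟩
        k/1 ℚ.* E                              ∎

    hi : k · c k -ʳ fromℚ η ≤ʳ fromℚ 1ℚ
    hi q (_ , (a , b , (_ , (p , (E , excE , p<E) , refl) , a<kp) , b≮η , refl) , q<a-b) =
      begin-strict
        q                                        <⟨ q<a-b ⟩
        a ℚ.- b                                  <⟨ p<q,s≤r⇒p-r<q-s a<1+1/D (ℚ.≤-trans 1/D≤η (ℚ.≮⇒≥ b≮η)) ⟩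
        1ℚ ℚ.+ + 1 / D ℚ.- + 1 / D               ≡⟨ ℚ.+-assoc 1ℚ (+ 1 / D) (ℚ.- (+ 1 / D)) ⟩
        1ℚ ℚ.+ (+ 1 / D ℚ.- + 1 / D)             ≡⟨ cong (1ℚ ℚ.+_) (ℚ.+-inverseʳ (+ 1 / D)) ⟩
        1ℚ ℚ.+ 0ℚ                                ≡⟨ ℚ.+-identityʳ 1ℚ ⟩
        1ℚ                                       ∎
      where
      instance _ = m*n≢0 1 (1 + k ^ 2)
      -- This is `k (k + 1) / (k² + 1) ≤ 1 + 1 / D` cleared of denominators; it comes down to
      -- `k * D ≤ k * k`, true since `D ≤ 64 D² ≤ k`.
      numerator : k * suc k * (1 * D) ≤ (1 * D + 1 * 1) * (1 * (1 + k ^ 2))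
      numerator = N.begin
        k * suc k * (1 * D)                      N.≡⟨ e k D ⟩
        D * (k * k) + k * D                      N.≤⟨ +-monoʳ-≤ (D * (k * k)) (*-monoʳ-≤ k (≤-trans 64D²≥D 64D²≤k)) ⟩
        D * (k * k) + k * k                      N.≤⟨ m≤m+n _ (D + 1) ⟩
        D * (k * k) + k * k + (D + 1)            N.≡⟨ e′ k D ⟩
        (1 * D + 1 * 1) * (1 * (1 + k ^ 2))      N.∎
        where
        module N = ≤-Reasoning
        e : ∀ k D → k * (1 + k) * (1 * D) ≡ D * (k * k) + k * D
        e = solve-∀
        e′ : ∀ k D → D * (k * k) + k * k + (D + 1) ≡ (1 * D + 1 * 1) * (1 * (1 + k * (k * 1)))
        e′ = solve-∀
      a<1+1/D : a ℚ.< 1ℚ ℚ.+ + 1 / D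
      a<1+1/D = begin-strict
        a                                        <⟨ a<kp ⟩
        (+ k / 1) ℚ.* p                          ≤⟨ ℚ.*-monoˡ-≤-nonNeg (+ k / 1) {{ℚ.normalize-nonNeg k 1}}
                                                      (ℚ.≤-trans (ℚ.<⇒≤ p<E) (Excess-≤ excE)) ⟩
        (+ k / 1) ℚ.* (+ suc k / (1 + k ^ 2))    ≡⟨ /-*-/ k 1 (suc k) (1 + k ^ 2) ⟩
        + (k * suc k) / (1 * (1 + k ^ 2))        ≤⟨ /-mono-≤ (k * suc k) (1 * (1 + k ^ 2)) (1 * D + 1 * 1) (1 * D) numerator ⟩
        + (1 * D + 1 * 1) / (1 * D)              ≡⟨ /-+-/ 1 1 1 D ⟨
        1ℚ ℚ.+ + 1 / D                           ∎

theorem5p4 : ((Δ : ℕ) .{{_ : NonZero Δ}} → 8 ≤ Δ →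
    c Δ ≥ʳ fromℚ (+ 1 / Δ) -ʳ 6 · (Δ ^-4/3))
    × ((λ Δ → Δ · c Δ) ⟶ fromℚ 1ℚ)
theorem5p4 = lowerBound , limit
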